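{- (Postponement of parallel $\bot$-reduction.) For all $s,t\in\Lambda^\infty$: if $s\to^\infty_{\beta\bot}t$ then there exists $r\in\Lambda^\infty$ such that $s\to^\infty_\beta r$ and $r\Rightarrow_\bot t$.
   Context: Fix an infinite set $V$ of variables and a set $C$ of constants with $V\cap C=\emptyset$, containing a distinguished constant $\bot$. $\Lambda^\infty$ is the set of infinitary lambda-terms: all finite and infinite terms generated coinductively by $t ::= c \mid x \mid t\,t \mid \lambda x.t$, identified up to $\alpha$-equivalence (fresh variables are assumed always available). $s[t/x]$ is capture-avoiding substitution, $\equiv$ identity of terms, an atom is a variable or constant. For $R\subseteq\Lambda^\infty\times\Lambda^\infty$, the compatible closure $\to_R$ is the least relation with: $(s,t)\in R\Rightarrow s\to_R t$; $s\to_R s'\Rightarrow st\to_R s't,\ ts\to_R ts',\ \lambda x.s\to_R\lambda x.s'$. $R_\beta=\{((\lambda x.s)t, s[t/x])\}$, $\to_\beta$ its compatible closure, $\to^*_\beta$ its reflexive-transitive closure. A term is in head normal form (hnf) if it is $\lambda x_1\ldots x_m.\,a\,t_1\ldots t_n$ ($m,n\ge0$, $a$ an atom, $a\not\equiv\bot$); $t$ has a hnf if $t\to^*_\beta t'$ with $t'$ in hnf. $R_\bot=\{(t,\bot)\mid t\text{ has no hnf}, t\not\equiv\bot\}$; $\to_{\beta\bot}$ is the compatible closure of $R_\beta\cup R_\bot$. The infinitary closure $\to^\infty$ of a relation $\to$ (with reflexive-transitive closure $\to^*$) is the greatest relation such that whenever $s\to^\infty t$: $t\equiv a$ atom and $s\to^*a$;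 or $t\equiv t_1't_2'$, $s\to^*t_1t_2$, $t_i\to^\infty t_i'$; or $t\equiv\lambda x.r'$, $s\to^*\lambda x.r$, $r\to^\infty r'$. $\to^\infty_\beta$ and $\to^\infty_{\beta\bot}$ are the infinitary closures of $\to_\beta$ and $\to_{\beta\bot}$. Parallel $\bot$-reduction $\Rightarrow_\bot$ is the greatest relation such that whenever $s\Rightarrow_\bot t$, one of: $(s,t)\in R_\bot$; $s\equiv t\equiv a$ an atom; $s\equiv s_1s_2$, $t\equiv t_1t_2$ with $s_i\Rightarrow_\bot t_i$ ($i=1,2$); $s\equiv\lambda x.s'$, $t\equiv\lambda x.t'$ with $s'\Rightarrow_\bot t'$. -}

module Defs where

open import Data.List.Base using (List; []; _∷_)
open import Data.Maybe.Base using (Maybe; just; nothing) renaming (map to mapMaybe)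
open import Data.Product.Base using (_×_; Σ-syntax; ∃-syntax)
open import Data.Sum.Base using (_⊎_)
open import Data.Unit.Base using (⊤)
open import Relation.Binary.PropositionalEquality.Core using (_≡_; _≢_)
open import Relation.Nullary.Negation.Core using (¬_)

-- Directions in the syntax tree: function part, argument part, body of an
-- abstraction.
data Dir : Set where
  fun arg body : Dir

-- The variables in scope after moving to a child, or along a path, in a term
-- over V.  In the body of an abstraction, nothing is the variable it binds.
childScope : Set → Dir → Set
childScope V fun  = V
childScope V arg  = V
childScope V body = Maybe V

scope : Set → List Dir → Set
scope V []      = V
scope V (d ∷ p) = scope (childScope V d) p

-- C is the set of constants and bot the distinguished one.  Variables are
-- the elements of an arbitrary set V; binders extend V by Maybe, which
-- represents terms up to α-equivalence and provides the fresh variable, so V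
-- need not be infinite.
module InfinitaryLambda (C : Set) (bot : C) where

  data Atom (V : Set) : Set where
    con : C → Atom V
    var : V → Atom V

  data Label (V : Set) : Set where
    atom : Atom V → Label V
    app  : Label V
    lam  : Label V

  -- Finite and infinite terms, i.e. the final coalgebra of
  --   F T V = Atom V ⊎ (T V × T V) ⊎ T (Maybe V),
  -- as labelled trees.  A term is a labelling of all paths; the labels on paths
  -- that leave the tree (for instance below an atom) are irrelevant and are
  -- ignored by _≈_ below.
  Λ∞ : Set → Set
  Λ∞ V = (p : List Dir) → Label (scope V p)

  infixl 9 _↓_
  _↓_ : ∀ {V : Set} → Λ∞ V → (d : Dir) → Λ∞ (childScope V d)
  (t ↓ d) p = t (d ∷ p)

  data HasChild {V : Set} : Label V → Dir → Set where
    app-fun  : HasChild app fun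
    app-arg  : HasChild app arg
    lam-body : HasChild lam body

  Position : ∀ {V : Set} → Λ∞ V → List Dir → Set
  Position t []      = ⊤
  Position t (d ∷ p) = HasChild (t []) d × Position (t ↓ d) p

  -- Identity of terms.  Labels determine which children exist, so agreement on
  -- all positions of s already implies that s and t have the same positions.
  infix 4 _≈_
  _≈_ : ∀ {V : Set} → Λ∞ V → Λ∞ V → Set
  s ≈ t = ∀ p → Position s p → s p ≡ t p

  -- In the three constructors, app labels the irrelevant paths.
  ⟨_⟩ : ∀ {V : Set} → Atom V → Λ∞ V
  ⟨ a ⟩ []      = atom a
  ⟨ a ⟩ (_ ∷ _) = app

  infixl 7 _·_
  _·_ : ∀ {V : Set} → Λ∞ V → Λ∞ V → Λ∞ V
  (s · t) []         = app
  (s · t) (fun ∷ p)  = s p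
  (s · t) (arg ∷ p)  = t p
  (s · t) (body ∷ _) = app

  infix 6 ƛ_
  ƛ_ : ∀ {V : Set} → Λ∞ (Maybe V) → Λ∞ V
  (ƛ s) []         = lam
  (ƛ s) (fun ∷ _)  = app
  (ƛ s) (arg ∷ _)  = app
  (ƛ s) (body ∷ p) = s p

  renLabel : ∀ {V W : Set} → (V → W) → Label V → Label W
  renLabel ρ (atom (con c)) = atom (con c)
  renLabel ρ (atom (var x)) = atom (var (ρ x))
  renLabel ρ app            = app
  renLabel ρ lam            = lam

  ren : ∀ {V W : Set} → (V → W) → Λ∞ V → Λ∞ W
  ren ρ t []         = renLabel ρ (t [])
  ren ρ t (fun ∷ p)  = ren ρ (t ↓ fun) p
  ren ρ t (arg ∷ p)  = ren ρ (t ↓ arg) p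
  ren ρ t (body ∷ p) = ren (mapMaybe ρ) (t ↓ body) p

  lift : ∀ {V W : Set} → (V → Λ∞ W) → Maybe V → Λ∞ (Maybe W)
  lift σ nothing  = ⟨ var nothing ⟩
  lift σ (just x) = ren just (σ x)

  -- subAt σ t (t []) is the simultaneous substitution of σ in t, by recursion
  -- on the path.
  mutual
    sub : ∀ {V W : Set} → (V → Λ∞ W) → Λ∞ V → Λ∞ W
    sub σ t p = subAt σ t (t []) p

    subAt : ∀ {V W : Set} → (V → Λ∞ W) → Λ∞ V → Label V → Λ∞ W
    subAt σ t (atom (var x)) p          = σ x p
    subAt σ t (atom (con c)) p          = ⟨ con c ⟩ p
    subAt σ t app            []         = app
    subAt σ t app            (fun ∷ p)  = sub σ (t ↓ fun) p
    subAt σ t app            (arg ∷ p)  = sub σ (t ↓ arg) p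
    subAt σ t app            (body ∷ _) = app
    subAt σ t lam            []         = lam
    subAt σ t lam            (fun ∷ _)  = app
    subAt σ t lam            (arg ∷ _)  = app
    subAt σ t lam            (body ∷ p) = sub (lift σ) (t ↓ body) p

  inst : ∀ {V : Set} → Λ∞ V → Maybe V → Λ∞ V
  inst t nothing  = t
  inst t (just x) = ⟨ var x ⟩

  infix 8 _[_]
  _[_] : ∀ {V : Set} → Λ∞ (Maybe V) → Λ∞ V → Λ∞ V
  s [ t ] = sub (inst t) s

  -- A relation is given for every set of variables at once, so that it can be
  -- applied below abstractions.  In all relations below, the shape of a term is
  -- prescribed up to ≈.
  Relation : Set₁
  Relation = ∀ {V : Set} → Λ∞ V → Λ∞ V → Set

  data Compatible (R : Relation) {V : Set} (s t : Λ∞ V) : Set where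
    base : R s t → Compatible R s t
    appˡ : ∀ {s₁ t₁ u} → s ≈ s₁ · u → Compatible R s₁ t₁ → t ≈ t₁ · u →
           Compatible R s t
    appʳ : ∀ {u s₂ t₂} → s ≈ u · s₂ → Compatible R s₂ t₂ → t ≈ u · t₂ →
           Compatible R s t
    abs  : ∀ {s′ t′} → s ≈ ƛ s′ → Compatible R s′ t′ → t ≈ ƛ t′ →
           Compatible R s t

  -- Unlike the library's Star, reflexive up to ≈ rather than ≡.
  infixr 5 _◅_
  data Star (R : Relation) {V : Set} (s t : Λ∞ V) : Set where
    ε   : s ≈ t → Star R s t
    _◅_ : ∀ {u} → R s u → Star R u t → Star R s t

  -- The greatest relation X such that X s t always implies Φ X s t: the union
  -- of all relations with this property.
  Greatest : (Relation → Relation) → ∀ {V : Set} → Λ∞ V → Λ∞ V → Set₁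
  Greatest Φ s t =
    Σ[ X ∈ Relation ] (∀ {V} {s t : Λ∞ V} → X s t → Φ X s t) × X s t

  data InfinitaryStep (R X : Relation) {V : Set} (s t : Λ∞ V) : Set where
    atom : ∀ {a} → t ≈ ⟨ a ⟩ → Star R s ⟨ a ⟩ → InfinitaryStep R X s t
    app  : ∀ {t₁ t₂ t₁′ t₂′} → t ≈ t₁′ · t₂′ → Star R s (t₁ · t₂) →
           X t₁ t₁′ → X t₂ t₂′ → InfinitaryStep R X s t
    abs  : ∀ {r r′} → t ≈ ƛ r′ → Star R s (ƛ r) → X r r′ →
           InfinitaryStep R X s t

  Infinitary : Relation → ∀ {V : Set} → Λ∞ V → Λ∞ V → Set₁
  Infinitary R = Greatest (λ X → InfinitaryStep R X)

  infix 4 _→β_ _→β*_ _→β∞_ _→β⊥_ _→β⊥∞_ _⇒⊥_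

  Rβ : Relation
  Rβ s t = ∃[ u ] ∃[ v ] (s ≈ (ƛ u) · v) × (t ≈ u [ v ])

  _→β_ : Relation
  _→β_ = Compatible Rβ

  _→β*_ : Relation
  _→β*_ = Star _→β_

  _→β∞_ : ∀ {V : Set} → Λ∞ V → Λ∞ V → Set₁
  _→β∞_ = Infinitary _→β_

  -- The terms a t₁ … tₙ with a an atom other than bot.
  data Neutral {V : Set} (t : Λ∞ V) : Set where
    head : ∀ {a} → t ≈ ⟨ a ⟩ → a ≢ con bot → Neutral t
    app  : ∀ {u v} → t ≈ u · v → Neutral u → Neutral t

  data HNF {V : Set} (t : Λ∞ V) : Set where
    neutral : Neutral t → HNF t
    abs     : ∀ {u} → t ≈ ƛ u → HNF u → HNF t

  HasHNF : ∀ {V : Set} → Λ∞ V → Set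
  HasHNF t = ∃[ t′ ] (t →β* t′) × HNF t′

  R⊥ : Relation
  R⊥ s t = ¬ HasHNF s × ¬ (s ≈ ⟨ con bot ⟩) × t ≈ ⟨ con bot ⟩

  Rβ⊥ : Relation
  Rβ⊥ s t = Rβ s t ⊎ R⊥ s t

  _→β⊥_ : Relation
  _→β⊥_ = Compatible Rβ⊥

  _→β⊥∞_ : ∀ {V : Set} → Λ∞ V → Λ∞ V → Set₁
  _→β⊥∞_ = Infinitary _→β⊥_

  data ParallelStep (X : Relation) {V : Set} (s t : Λ∞ V) : Set where
    base : R⊥ s t → ParallelStep X s t
    atom : ∀ {a} → s ≈ ⟨ a ⟩ → t ≈ ⟨ a ⟩ → ParallelStep X s t
    app  : ∀ {s₁ s₂ t₁ t₂} → s ≈ s₁ · s₂ → t ≈ t₁ · t₂ →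
           X s₁ t₁ → X s₂ t₂ → ParallelStep X s t
    abs  : ∀ {s′ t′} → s ≈ ƛ s′ → t ≈ ƛ t′ → X s′ t′ → ParallelStep X s t

  _⇒⊥_ : ∀ {V : Set} → Λ∞ V → Λ∞ V → Set₁
  _⇒⊥_ = Greatest (λ X → ParallelStep X)

{-# OPTIONS --safe #-}
module Submission where

-- A term has a head normal form iff head reduction finds one (standardisation).
-- Hence terms without hnf are closed under substitution, so s ⇒⊥ t →β u gives
-- s →β* r ⇒⊥ u, and a term whose ⇒⊥-reduct has no hnf has none itself, so that
-- ⇒⊥ absorbs subsequent ⊥-steps.  Therefore s ⇒⊥ t →β⊥* u gives s →β* r ⇒⊥ u.
-- Applied at the root and corecursively at the children of the term reached,
-- this produces the β-reduct layer by layer.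

open import Data.Empty using (⊥-elim)
open import Data.List.Base using (List; []; _∷_)
open import Data.Maybe.Base using (Maybe; just; nothing) renaming (map to mapMaybe)
open import Data.Nat.Base using (ℕ; zero; suc)
open import Data.Product.Base using (_×_; _,_; proj₁; proj₂; Σ-syntax; ∃-syntax)
open import Data.Sum.Base using (_⊎_; inj₁; inj₂)
open import Data.Unit.Base using (⊤; tt)
open import Relation.Binary.PropositionalEquality.Core
  using (_≡_; refl; sym; trans; cong; subst)
open import Relation.Nullary.Negation.Core using (¬_)
open import Defs

-- The obstacle is to transport the negative statement "no hnf". No case distinction on having an
-- hnf is made: each transport is proved as its contrapositive, on the positive inductive evidence
-- `HN`. Two observations carry this. If a substitution creates a redex at the head of a term, a
-- variable stood there, so the term was neutral already. And in a term with an hnf every function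
-- part along the spine has an hnf too, so a parallel ⊥-step cannot erase any of them, and the weak
-- head reduction can be copied on the other side. The two simulations run in opposite directions.
-- Head reductions are carried forward from `s` to `t` along `s ⇛ t`, which needs `HN`. Arbitrary
-- steps of `t` are carried back to `s`, which works because ⊥-steps create no β-redex.

module Postponement (C : Set) (bot : C) where
  open InfinitaryLambda C bot

  private variable
    U V W : Set
    R : Relation

  -- Identity of terms

  ≈-refl : {s : Λ∞ V} → s ≈ s
  ≈-refl _ _ = refl

  ↓-cong : {s t : Λ∞ V} {d : Dir} → HasChild (s []) d → s ≈ t → s ↓ d ≈ t ↓ d
  ↓-cong {d = d} h e p q = e (d ∷ p) (h , q)

  -- `≈` quantifies over the positions of its left side only, so symmetry needs this transfer: equal
  -- labels have the same children.
  Position-≈ : {s t : Λ∞ V} → s ≈ t → ∀ p → Position t p → Position s p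
  Position-≈ e [] _ = tt
  Position-≈ e (d ∷ p) (h , q) = h′ , Position-≈ (↓-cong h′ e) p q
    where h′ = subst (λ l → HasChild l d) (sym (e [] tt)) h

  ≈-sym : {s t : Λ∞ V} → s ≈ t → t ≈ s
  ≈-sym e p q = sym (e p (Position-≈ e p q))

  Position-≈′ : {s t : Λ∞ V} → s ≈ t → ∀ p → Position s p → Position t p
  Position-≈′ e = Position-≈ (≈-sym e)

  ≈-trans : {s t u : Λ∞ V} → s ≈ t → t ≈ u → s ≈ u
  ≈-trans e f p q = trans (e p q) (f p (Position-≈′ e p q))

  ≈-root : {s t u : Λ∞ V} → s ≈ t → s ≈ u → t [] ≡ u []
  ≈-root e f = trans (sym (e [] tt)) (f [] tt)

  ≈-atom : {t : Λ∞ V} {a : Atom V} → t [] ≡ atom a → t ≈ ⟨ a ⟩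
  ≈-atom e [] _ = e
  ≈-atom e (d ∷ _) (h , _) with () ← subst (λ l → HasChild l d) e h

  ≈-app : {t : Λ∞ V} {a b : Λ∞ V} → t [] ≡ app → t ↓ fun ≈ a → t ↓ arg ≈ b → t ≈ a · b
  ≈-app e f g [] _ = e
  ≈-app e f g (fun ∷ p) (_ , q) = f p q
  ≈-app e f g (arg ∷ p) (_ , q) = g p q
  ≈-app e f g (body ∷ _) (h , _) with () ← subst (λ l → HasChild l body) e h

  ≈-lam : {t : Λ∞ V} {a : Λ∞ (Maybe V)} → t [] ≡ lam → t ↓ body ≈ a → t ≈ ƛ a
  ≈-lam e f [] _ = e
  ≈-lam e f (body ∷ p) (_ , q) = f p q
  ≈-lam e f (fun ∷ _) (h , _) with () ← subst (λ l → HasChild l fun) e h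
  ≈-lam e f (arg ∷ _) (h , _) with () ← subst (λ l → HasChild l arg) e h

  ·-cong : {a b c d : Λ∞ V} → a ≈ c → b ≈ d → a · b ≈ c · d
  ·-cong = ≈-app refl

  ƛ-cong : {a b : Λ∞ (Maybe V)} → a ≈ b → ƛ a ≈ ƛ b
  ƛ-cong = ≈-lam refl

  ·-injective : {a b c d : Λ∞ V} → a · b ≈ c · d → a ≈ c × b ≈ d
  ·-injective e = ↓-cong app-fun e , ↓-cong app-arg e

  ƛ-injective : {a b : Λ∞ (Maybe V)} → ƛ a ≈ ƛ b → a ≈ b
  ƛ-injective = ↓-cong lam-body

  data View (t : Λ∞ V) : Set where
    con : ∀ c → t ≈ ⟨ con c ⟩ → View t
    var : ∀ x → t ≈ ⟨ var x ⟩ → View t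
    app : ∀ t₁ t₂ → t ≈ t₁ · t₂ → View t
    lam : ∀ t′ → t ≈ ƛ t′ → View t

  view : (t : Λ∞ V) → View t
  view t with t [] in e
  ... | atom (con c) = con c (≈-atom e)
  ... | atom (var x) = var x (≈-atom e)
  ... | app = app (t ↓ fun) (t ↓ arg) (≈-app e ≈-refl ≈-refl)
  ... | lam = lam (t ↓ body) (≈-lam e ≈-refl)

  -- Renaming and substitution

  renLabel-id : {ρ : V → V} → (∀ x → ρ x ≡ x) → ∀ l → renLabel ρ l ≡ l
  renLabel-id h (atom (con c)) = refl
  renLabel-id h (atom (var x)) = cong (λ y → atom (var y)) (h x)
  renLabel-id h app = refl
  renLabel-id h lam = refl

  renLabel-∘ : {ρ : V → W} {ρ′ : U → V} {τ : U → W} → (∀ x → ρ (ρ′ x) ≡ τ x) →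
               ∀ l → renLabel ρ (renLabel ρ′ l) ≡ renLabel τ l
  renLabel-∘ h (atom (con c)) = refl
  renLabel-∘ h (atom (var x)) = cong (λ y → atom (var y)) (h x)
  renLabel-∘ h app = refl
  renLabel-∘ h lam = refl

  mapMaybe-id : {ρ : V → V} → (∀ x → ρ x ≡ x) → ∀ x → mapMaybe ρ x ≡ x
  mapMaybe-id h nothing = refl
  mapMaybe-id h (just x) = cong just (h x)

  mapMaybe-∘ : {ρ : V → W} {ρ′ : U → V} {τ : U → W} → (∀ x → ρ (ρ′ x) ≡ τ x) →
               ∀ x → mapMaybe ρ (mapMaybe ρ′ x) ≡ mapMaybe τ x
  mapMaybe-∘ h nothing = refl
  mapMaybe-∘ h (just x) = cong just (h x)

  ren-id : {ρ : V → V} → (∀ x → ρ x ≡ x) → ∀ t → ren ρ t ≈ t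
  ren-id h t [] _ = renLabel-id h (t [])
  ren-id h t (fun ∷ p) (_ , q) = ren-id h (t ↓ fun) p q
  ren-id h t (arg ∷ p) (_ , q) = ren-id h (t ↓ arg) p q
  ren-id h t (body ∷ p) (_ , q) = ren-id (mapMaybe-id h) (t ↓ body) p q

  -- The composite is a separate `τ`, related pointwise: below a binder the composite of the
  -- extended maps agrees with the extended composite only pointwise. The later composition laws
  -- take the same form.
  ren-ren : {ρ : V → W} {ρ′ : U → V} {τ : U → W} → (∀ x → ρ (ρ′ x) ≡ τ x) →
            ∀ t → ren ρ (ren ρ′ t) ≈ ren τ t
  ren-ren h t [] _ = renLabel-∘ h (t [])
  ren-ren h t (fun ∷ p) (_ , q) = ren-ren h (t ↓ fun) p q
  ren-ren h t (arg ∷ p) (_ , q) = ren-ren h (t ↓ arg) p q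
  ren-ren h t (body ∷ p) (_ , q) = ren-ren (mapMaybe-∘ h) (t ↓ body) p q

  HasChild-ren⁻ : {ρ : V → W} {d : Dir} (l : Label V) → HasChild (renLabel ρ l) d → HasChild l d
  HasChild-ren⁻ (atom (con c)) ()
  HasChild-ren⁻ (atom (var x)) ()
  HasChild-ren⁻ app app-fun = app-fun
  HasChild-ren⁻ app app-arg = app-arg
  HasChild-ren⁻ lam lam-body = lam-body

  ren-cong : {ρ : V → W} {s t : Λ∞ V} → s ≈ t → ren ρ s ≈ ren ρ t
  ren-cong {ρ = ρ} e [] _ = cong (renLabel ρ) (e [] tt)
  ren-cong {s = s} e (fun ∷ p) (h , q) =
    ren-cong (↓-cong (HasChild-ren⁻ (s []) h) e) p q
  ren-cong {s = s} e (arg ∷ p) (h , q) =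
    ren-cong (↓-cong (HasChild-ren⁻ (s []) h) e) p q
  ren-cong {s = s} e (body ∷ p) (h , q) =
    ren-cong (↓-cong (HasChild-ren⁻ (s []) h) e) p q

  lift-cong : {σ τ : V → Λ∞ W} → (∀ x → σ x ≈ τ x) → ∀ x → lift σ x ≈ lift τ x
  lift-cong h nothing = ≈-refl
  lift-cong h (just x) = ren-cong (h x)

  mutual
    sub-cong : {σ τ : V → Λ∞ W} {s t : Λ∞ V} → (∀ x → σ x ≈ τ x) → s ≈ t → sub σ s ≈ sub τ t
    sub-cong h e = subAt-cong h e refl (e [] tt)

    -- The labels are arguments tied to the terms by equations, so that matching on them lets both
    -- substitutions compute.
    subAt-cong : {σ τ : V → Λ∞ W} {s t : Λ∞ V} {l l′ : Label V} →
                 (∀ x → σ x ≈ τ x) → s ≈ t → s [] ≡ l → l ≡ l′ → subAt σ s l ≈ subAt τ t l′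
    subAt-cong {l = atom (con c)} h e i refl p q = refl
    subAt-cong {l = atom (var x)} h e i refl p q = h x p q
    subAt-cong {l = app} h e i refl [] q = refl
    subAt-cong {l = app} h e i refl (fun ∷ p) (_ , q) =
      sub-cong h (↓-cong (subst (λ l → HasChild l fun) (sym i) app-fun) e) p q
    subAt-cong {l = app} h e i refl (arg ∷ p) (_ , q) =
      sub-cong h (↓-cong (subst (λ l → HasChild l arg) (sym i) app-arg) e) p q
    subAt-cong {l = lam} h e i refl [] q = refl
    subAt-cong {l = lam} h e i refl (body ∷ p) (_ , q) =
      sub-cong (lift-cong h)
        (↓-cong (subst (λ l → HasChild l body) (sym i) lam-body) e) p q

  lift-var : {σ : V → Λ∞ W} {ρ : V → W} → (∀ x → σ x ≈ ⟨ var (ρ x) ⟩) →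
             ∀ x → lift σ x ≈ ⟨ var (mapMaybe ρ x) ⟩
  lift-var h nothing = ≈-refl
  lift-var {σ = σ} {ρ} h (just x) = ≈-atom (cong (renLabel just) (h x [] tt))

  mutual
    sub≈ren : {σ : V → Λ∞ W} {ρ : V → W} → (∀ x → σ x ≈ ⟨ var (ρ x) ⟩) →
              ∀ t → sub σ t ≈ ren ρ t
    sub≈ren h t = subAt≈ren h t (t []) refl

    subAt≈ren : {σ : V → Λ∞ W} {ρ : V → W} → (∀ x → σ x ≈ ⟨ var (ρ x) ⟩) →
                ∀ t l → t [] ≡ l → subAt σ t l ≈ ren ρ t
    subAt≈ren {ρ = ρ} h t (atom (con c)) e [] q = sym (cong (renLabel ρ) e)
    subAt≈ren {ρ = ρ} h t (atom (var x)) e [] q = trans (h x [] tt) (sym (cong (renLabel ρ) e))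
    subAt≈ren h t (atom (var x)) e (d ∷ p) (c , q) with () ← subst (λ l → HasChild l d) (h x [] tt) c
    subAt≈ren {ρ = ρ} h t app e [] q = sym (cong (renLabel ρ) e)
    subAt≈ren h t app e (fun ∷ p) (_ , q) = sub≈ren h (t ↓ fun) p q
    subAt≈ren h t app e (arg ∷ p) (_ , q) = sub≈ren h (t ↓ arg) p q
    subAt≈ren {ρ = ρ} h t lam e [] q = sym (cong (renLabel ρ) e)
    subAt≈ren h t lam e (body ∷ p) (_ , q) = sub≈ren (lift-var h) (t ↓ body) p q

  sub-id : {σ : V → Λ∞ V} → (∀ x → σ x ≈ ⟨ var x ⟩) → ∀ t → sub σ t ≈ t
  sub-id h t = ≈-trans (sub≈ren h t) (ren-id (λ _ → refl) t)

  lift-ren : {σ : V → Λ∞ W} {ρ : U → V} {τ : U → Λ∞ W} → (∀ x → σ (ρ x) ≈ τ x) →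
             ∀ x → lift σ (mapMaybe ρ x) ≈ lift τ x
  lift-ren h nothing = ≈-refl
  lift-ren h (just x) = ren-cong (h x)

  mutual
    sub-ren : {σ : V → Λ∞ W} {ρ : U → V} {τ : U → Λ∞ W} → (∀ x → σ (ρ x) ≈ τ x) →
              ∀ t → sub σ (ren ρ t) ≈ sub τ t
    sub-ren h t = sub-renAt h t (t [])

    sub-renAt : {σ : V → Λ∞ W} {ρ : U → V} {τ : U → Λ∞ W} → (∀ x → σ (ρ x) ≈ τ x) →
                ∀ t l → subAt σ (ren ρ t) (renLabel ρ l) ≈ subAt τ t l
    sub-renAt h t (atom (con c)) p q = refl
    sub-renAt h t (atom (var x)) p q = h x p q
    sub-renAt h t app [] q = refl
    sub-renAt h t app (fun ∷ p) (_ , q) = sub-ren h (t ↓ fun) p q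
    sub-renAt h t app (arg ∷ p) (_ , q) = sub-ren h (t ↓ arg) p q
    sub-renAt h t lam [] q = refl
    sub-renAt h t lam (body ∷ p) (_ , q) = sub-ren (lift-ren h) (t ↓ body) p q

  ren-lift : {ρ : V → W} {σ : U → Λ∞ V} {τ : U → Λ∞ W} → (∀ x → ren ρ (σ x) ≈ τ x) →
             ∀ x → ren (mapMaybe ρ) (lift σ x) ≈ lift τ x
  ren-lift h nothing = ≈-atom refl
  ren-lift {ρ = ρ} {σ} {τ} h (just x) =
    ≈-trans (ren-ren (λ _ → refl) (σ x))
      (≈-trans (≈-sym (ren-ren (λ _ → refl) (σ x)))
        (ren-cong (h x)))

  mutual
    ren-sub : {ρ : V → W} {σ : U → Λ∞ V} {τ : U → Λ∞ W} → (∀ x → ren ρ (σ x) ≈ τ x) →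
              ∀ t → ren ρ (sub σ t) ≈ sub τ t
    ren-sub h t = ren-subAt h t (t [])

    ren-subAt : {ρ : V → W} {σ : U → Λ∞ V} {τ : U → Λ∞ W} → (∀ x → ren ρ (σ x) ≈ τ x) →
                ∀ t l → ren ρ (subAt σ t l) ≈ subAt τ t l
    ren-subAt h t (atom (con c)) [] q = refl
    ren-subAt h t (atom (var x)) p q = h x p q
    ren-subAt h t app [] q = refl
    ren-subAt h t app (fun ∷ p) (_ , q) = ren-sub h (t ↓ fun) p q
    ren-subAt h t app (arg ∷ p) (_ , q) = ren-sub h (t ↓ arg) p q
    ren-subAt h t lam [] q = refl
    ren-subAt h t lam (body ∷ p) (_ , q) = ren-sub (ren-lift h) (t ↓ body) p q

  -- `lift` weakens by the renaming `just`; the two mixed laws `sub-ren` and `ren-sub` move this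
  -- weakening past `σ`. Hence they precede `sub-sub`.
  sub-lift : {σ : V → Λ∞ W} {τ : U → Λ∞ V} {υ : U → Λ∞ W} → (∀ x → sub σ (τ x) ≈ υ x) →
             ∀ x → sub (lift σ) (lift τ x) ≈ lift υ x
  sub-lift h nothing = ≈-refl
  sub-lift {σ = σ} {τ} {υ} h (just x) =
    ≈-trans (sub-ren (λ _ → ≈-refl) (τ x))
      (≈-trans (≈-sym (ren-sub (λ _ → ≈-refl) (τ x)))
        (ren-cong (h x)))

  mutual
    sub-sub : {σ : V → Λ∞ W} {τ : U → Λ∞ V} {υ : U → Λ∞ W} → (∀ x → sub σ (τ x) ≈ υ x) →
              ∀ t → sub σ (sub τ t) ≈ sub υ t
    sub-sub h t = sub-subAt h t (t [])

    sub-subAt : {σ : V → Λ∞ W} {τ : U → Λ∞ V} {υ : U → Λ∞ W} → (∀ x → sub σ (τ x) ≈ υ x) →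
                ∀ t l → sub σ (subAt τ t l) ≈ subAt υ t l
    sub-subAt h t (atom (con c)) p q = refl
    sub-subAt h t (atom (var x)) p q = h x p q
    sub-subAt h t app [] q = refl
    sub-subAt h t app (fun ∷ p) (_ , q) = sub-sub h (t ↓ fun) p q
    sub-subAt h t app (arg ∷ p) (_ , q) = sub-sub h (t ↓ arg) p q
    sub-subAt h t lam [] q = refl
    sub-subAt h t lam (body ∷ p) (_ , q) = sub-sub (sub-lift h) (t ↓ body) p q

  sub-con : {σ : V → Λ∞ W} {t : Λ∞ V} {c : C} → t ≈ ⟨ con c ⟩ → sub σ t ≈ ⟨ con c ⟩
  sub-con {σ = σ} e = ≈-trans (sub-cong {σ = σ} (λ _ → ≈-refl) e) (≈-atom refl)

  sub-var : {σ : V → Λ∞ W} {t : Λ∞ V} {x : V} → t ≈ ⟨ var x ⟩ → sub σ t ≈ σ x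
  sub-var {σ = σ} e = sub-cong {σ = σ} (λ _ → ≈-refl) e

  sub-app : {σ : V → Λ∞ W} {t a b : Λ∞ V} → t ≈ a · b → sub σ t ≈ sub σ a · sub σ b
  sub-app {σ = σ} e = ≈-trans (sub-cong {σ = σ} (λ _ → ≈-refl) e) (≈-app refl ≈-refl ≈-refl)

  sub-lam : {σ : V → Λ∞ W} {t : Λ∞ V} {a : Λ∞ (Maybe V)} → t ≈ ƛ a → sub σ t ≈ ƛ sub (lift σ) a
  sub-lam {σ = σ} e = ≈-trans (sub-cong {σ = σ} (λ _ → ≈-refl) e) (≈-lam refl ≈-refl)

  renAtom : (V → W) → Atom V → Atom W
  renAtom ρ (con c) = con c
  renAtom ρ (var x) = var (ρ x)

  ren-atom : {ρ : V → W} {t : Λ∞ V} {a : Atom V} → t ≈ ⟨ a ⟩ → ren ρ t ≈ ⟨ renAtom ρ a ⟩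
  ren-atom {ρ = ρ} {a = con c} e = ≈-trans (ren-cong {ρ = ρ} e) (≈-atom refl)
  ren-atom {ρ = ρ} {a = var x} e = ≈-trans (ren-cong {ρ = ρ} e) (≈-atom refl)

  ren-app : {ρ : V → W} {t a b : Λ∞ V} → t ≈ a · b → ren ρ t ≈ ren ρ a · ren ρ b
  ren-app {ρ = ρ} e = ≈-trans (ren-cong {ρ = ρ} e) (≈-app refl ≈-refl ≈-refl)

  ren-lam : {ρ : V → W} {t : Λ∞ V} {a : Λ∞ (Maybe V)} → t ≈ ƛ a → ren ρ t ≈ ƛ ren (mapMaybe ρ) a
  ren-lam {ρ = ρ} e = ≈-trans (ren-cong {ρ = ρ} e) (≈-lam refl ≈-refl)

  inst-cong : {s t : Λ∞ V} → s ≈ t → ∀ x → inst s x ≈ inst t x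
  inst-cong e nothing = e
  inst-cong e (just x) = ≈-refl

  -- Both sides are the single substitution `υ`, which sends the bound variable to `sub σ v` and any
  -- other `x` to `σ x`.
  sub-[] : (σ : V → Λ∞ W) (u : Λ∞ (Maybe V)) (v : Λ∞ V) →
           sub σ (u [ v ]) ≈ sub (lift σ) u [ sub σ v ]
  sub-[] σ u v = ≈-trans (sub-sub {υ = υ} (λ _ → ≈-refl) u) (≈-sym (sub-sub h u))
    where
    υ = λ x → sub σ (inst v x)
    h : ∀ x → sub (inst (sub σ v)) (lift σ x) ≈ υ x
    h nothing  = ≈-refl
    h (just x) = ≈-trans (sub-ren (λ _ → ≈-refl) (σ x)) (sub-id (λ _ → ≈-refl) (σ x))

  -- Reduction sequences

  Respˡ : Relation → Set₁
  Respˡ R = ∀ {V} {s t u : Λ∞ V} → s ≈ t → R t u → R s u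

  Star-respˡ : Respˡ R → Respˡ (Star R)
  Star-respˡ r e (ε f) = ε (≈-trans e f)
  Star-respˡ r e (x ◅ xs) = r e x ◅ xs

  Star-respʳ : {s t u : Λ∞ V} → Star R s t → t ≈ u → Star R s u
  Star-respʳ (ε f) e = ε (≈-trans f e)
  Star-respʳ (x ◅ xs) e = x ◅ Star-respʳ xs e

  Star-trans : Respˡ R → {s t u : Λ∞ V} → Star R s t → Star R t u → Star R s u
  Star-trans r (ε e) ys = Star-respˡ r e ys
  Star-trans r (x ◅ xs) ys = x ◅ Star-trans r xs ys

  Star-map : {R S : Relation} (F : Λ∞ V → Λ∞ W) → (∀ {s t} → s ≈ t → F s ≈ F t) →
             (∀ {s t} → R s t → S (F s) (F t)) → ∀ {s t} → Star R s t → Star S (F s) (F t)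
  Star-map F c f (ε e) = ε (c e)
  Star-map F c f (x ◅ xs) = f x ◅ Star-map F c f xs

  →β-respˡ : Respˡ _→β_
  →β-respˡ e (base (u , v , f , g)) = base (u , v , ≈-trans e f , g)
  →β-respˡ e (appˡ f x g) = appˡ (≈-trans e f) x g
  →β-respˡ e (appʳ f x g) = appʳ (≈-trans e f) x g
  →β-respˡ e (abs f x g) = abs (≈-trans e f) x g

  →β*-· : {s t u v : Λ∞ V} → s →β* t → u →β* v → (s · u) →β* (t · v)
  →β*-· {s = s} {t} {u} {v} xs ys =
    Star-trans →β-respˡ
      (Star-map (_· u) (λ e → ·-cong e ≈-refl) (λ x → appˡ ≈-refl x ≈-refl) xs)
      (Star-map (t ·_) (·-cong ≈-refl) (λ x → appʳ ≈-refl x ≈-refl) ys)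

  →β*-ƛ : {s t : Λ∞ (Maybe V)} → s →β* t → (ƛ s) →β* (ƛ t)
  →β*-ƛ = Star-map ƛ_ ƛ-cong (λ x → abs ≈-refl x ≈-refl)

  -- Weak head reduction

  infix 4 _→w_ _→w*_

  data _→w_ {V : Set} (s t : Λ∞ V) : Set where
    base : ∀ {u v} → s ≈ (ƛ u) · v → t ≈ u [ v ] → s →w t
    appˡ : ∀ {s₁ t₁ u} → s ≈ s₁ · u → s₁ →w t₁ → t ≈ t₁ · u → s →w t

  _→w*_ : Relation
  _→w*_ = Star _→w_

  →w-respˡ : Respˡ _→w_
  →w-respˡ e (base f g) = base (≈-trans e f) g
  →w-respˡ e (appˡ f x g) = appˡ (≈-trans e f) x g

  →w⇒→β : {s t : Λ∞ V} → s →w t → s →β t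
  →w⇒→β (base e f) = base (_ , _ , e , f)
  →w⇒→β (appˡ e x f) = appˡ e (→w⇒→β x) f

  →w-sub : (σ : V → Λ∞ W) {s t : Λ∞ V} → s →w t → sub σ s →w sub σ t
  →w-sub σ (base {u} {v} e f) =
    base (≈-trans (sub-app e) (·-cong (sub-lam ≈-refl) ≈-refl))
         (≈-trans (sub-cong (λ _ → ≈-refl) f) (sub-[] σ u v))
  →w-sub σ (appˡ e x f) = appˡ (sub-app e) (→w-sub σ x) (sub-app f)

  →w*-sub : (σ : V → Λ∞ W) {s t : Λ∞ V} → s →w* t → sub σ s →w* sub σ t
  →w*-sub σ = Star-map (sub σ) (sub-cong (λ _ → ≈-refl)) (→w-sub σ)

  →w*-ren : (ρ : V → W) {s t : Λ∞ V} → s →w* t → ren ρ s →w* ren ρ t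
  →w*-ren ρ {s} {t} xs =
    Star-respˡ →w-respˡ (≈-sym (sub≈ren (λ _ → ≈-refl) s))
      (Star-respʳ (→w*-sub (λ x → ⟨ var (ρ x) ⟩) xs) (sub≈ren (λ _ → ≈-refl) t))

  →w*-·ˡ : {s t u : Λ∞ V} → s →w* t → (s · u) →w* (t · u)
  →w*-·ˡ {u = u} = Star-map (_· u) (λ e → ·-cong e ≈-refl) (λ x → appˡ ≈-refl x ≈-refl)

  -- Standardisation

  -- The approximations from above of Infinitary _→w_.  Since an hnf is a finite
  -- piece of a term, a finite depth suffices, and no element of Set₁ is needed.
  Std : ℕ → Relation
  Std zero s t = ⊤
  Std (suc n) s t = InfinitaryStep _→w_ (Std n) s t

  Std-respʳ : ∀ n {s t u : Λ∞ V} → Std n s t → t ≈ u → Std n s u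
  Std-respʳ zero _ _ = tt
  Std-respʳ (suc n) (atom e xs) f = atom (≈-trans (≈-sym f) e) xs
  Std-respʳ (suc n) (app e xs x y) f = app (≈-trans (≈-sym f) e) xs x y
  Std-respʳ (suc n) (abs e xs x) f = abs (≈-trans (≈-sym f) e) xs x

  Std-expand : ∀ n {s t u : Λ∞ V} → s →w* t → Std n t u → Std n s u
  Std-expand zero _ _ = tt
  Std-expand (suc n) ys (atom e xs) = atom e (Star-trans →w-respˡ ys xs)
  Std-expand (suc n) ys (app e xs x y) = app e (Star-trans →w-respˡ ys xs) x y
  Std-expand (suc n) ys (abs e xs x) = abs e (Star-trans →w-respˡ ys xs) x

  Std-pred : ∀ n {s t : Λ∞ V} → Std (suc n) s t → Std n s t
  Std-pred zero _ = tt
  Std-pred (suc n) (atom e xs) = atom e xs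
  Std-pred (suc n) (app e xs x y) = app e xs (Std-pred n x) (Std-pred n y)
  Std-pred (suc n) (abs e xs x) = abs e xs (Std-pred n x)

  Std-refl : ∀ n {s : Λ∞ V} → Std n s s
  Std-refl zero = tt
  Std-refl (suc n) {s} with view s
  ... | con c e = atom e (ε e)
  ... | var x e = atom e (ε e)
  ... | app a b e = app e (ε e) (Std-refl n) (Std-refl n)
  ... | lam a e = abs e (ε e) (Std-refl n)

  Std-ren : ∀ n (ρ : V → W) {s t : Λ∞ V} → Std n s t → Std n (ren ρ s) (ren ρ t)
  Std-ren zero ρ _ = tt
  Std-ren (suc n) ρ (atom e xs) = atom (ren-atom e) (Star-respʳ (→w*-ren ρ xs) (ren-atom ≈-refl))
  Std-ren (suc n) ρ (app e xs x y) =
    app (ren-app e) (Star-respʳ (→w*-ren ρ xs) (ren-app ≈-refl)) (Std-ren n ρ x) (Std-ren n ρ y)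
  Std-ren (suc n) ρ (abs e xs x) =
    abs (ren-lam e) (Star-respʳ (→w*-ren ρ xs) (ren-lam ≈-refl)) (Std-ren n (mapMaybe ρ) x)

  Std-lift : ∀ n {σ τ : V → Λ∞ W} → (∀ x → Std n (σ x) (τ x)) → ∀ x → Std n (lift σ x) (lift τ x)
  Std-lift n h nothing = Std-refl n
  Std-lift n h (just x) = Std-ren n just (h x)

  -- Weak head reduction is stable under substitution. Where `s` reaches a variable `x`, the
  -- instance therefore reaches `σ x`, and the sequences given by the hypothesis on `x` are
  -- appended.
  Std-sub : ∀ n {σ τ : V → Λ∞ W} {s t : Λ∞ V} → (∀ x → Std n (σ x) (τ x)) → Std n s t →
          Std n (sub σ s) (sub τ t)
  Std-sub zero h _ = tt
  Std-sub (suc n) {σ} h (atom {con c} e xs) =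
    atom (sub-con e) (Star-respʳ (→w*-sub σ xs) (sub-con {σ = σ} ≈-refl))
  Std-sub (suc n) {σ} {τ} h (atom {var x} e xs) =
    Std-respʳ (suc n) (Std-expand (suc n) (Star-respʳ (→w*-sub σ xs) (sub-var {σ = σ} (≈-refl {s = ⟨ var x ⟩}))) (h x))
      (≈-sym (sub-var {σ = τ} e))
  Std-sub (suc n) {σ} h (app e xs x y) =
    app (sub-app e) (Star-respʳ (→w*-sub σ xs) (sub-app ≈-refl))
      (Std-sub n (λ z → Std-pred n (h z)) x) (Std-sub n (λ z → Std-pred n (h z)) y)
  Std-sub (suc n) {σ} h (abs e xs x) =
    abs (sub-lam e) (Star-respʳ (→w*-sub σ xs) (sub-lam ≈-refl))
      (Std-sub n (Std-lift n (λ z → Std-pred n (h z))) x)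

  Std-inst : ∀ {n} {s t : Λ∞ V} → Std n s t → ∀ x → Std n (inst s x) (inst t x)
  Std-inst d nothing = d
  Std-inst {n = n} d (just x) = Std-refl n

  -- A root β-step uses up two levels of t: the application and the abstraction.
  Std-β : ∀ n {s t t′ : Λ∞ V} → t →β t′ → Std (suc (suc n)) s t → Std n s t′
  Std-β zero _ _ = tt
  Std-β (suc n) (base (u , v , e , f)) (atom g _) with () ← ≈-root g e
  Std-β (suc n) (base (u , v , e , f)) (abs g _ _) with () ← ≈-root g e
  Std-β (suc n) (base (u , v , e , f)) (app g xs x y)
    with h₁ , h₂ ← ·-injective (≈-trans (≈-sym g) e) with Std-respʳ _ x h₁
  ... | atom k _ with () ← k [] tt
  ... | app k _ _ _ with () ← k [] tt
  ... | abs k ys z =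
    -- `xs` exposes an application and `ys` turns its function part into an abstraction, so
    -- contracting this redex is one more weak head step. `Std-sub` relates the two contracta.
    Std-expand (suc n)
      (Star-trans →w-respˡ xs (Star-trans →w-respˡ (→w*-·ˡ ys) (base ≈-refl ≈-refl ◅ ε ≈-refl)))
      (Std-respʳ (suc n)
        (Std-sub (suc n) (Std-inst (Std-pred (suc n) (Std-respʳ _ y h₂))) (Std-respʳ (suc n) z (≈-sym (ƛ-injective k))))
        (≈-sym f))
  Std-β (suc n) (appˡ e z f) (atom g _) with () ← ≈-root g e
  Std-β (suc n) (appˡ e z f) (abs g _ _) with () ← ≈-root g e
  Std-β (suc n) (appˡ e z f) (app g xs x y) with h₁ , h₂ ← ·-injective (≈-trans (≈-sym g) e) =
    app f xs (Std-β n z (Std-respʳ _ x h₁)) (Std-pred n (Std-pred (suc n) (Std-respʳ _ y h₂)))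
  Std-β (suc n) (appʳ e z f) (atom g _) with () ← ≈-root g e
  Std-β (suc n) (appʳ e z f) (abs g _ _) with () ← ≈-root g e
  Std-β (suc n) (appʳ e z f) (app g xs x y) with h₁ , h₂ ← ·-injective (≈-trans (≈-sym g) e) =
    app f xs (Std-pred n (Std-pred (suc n) (Std-respʳ _ x h₁))) (Std-β n z (Std-respʳ _ y h₂))
  Std-β (suc n) (abs e z f) (atom g _) with () ← ≈-root g e
  Std-β (suc n) (abs e z f) (app g _ _ _) with () ← ≈-root g e
  Std-β (suc n) (abs e z f) (abs g xs x) =
    abs f xs (Std-β n z (Std-respʳ _ x (ƛ-injective (≈-trans (≈-sym g) e))))

  -- The source `s` stays fixed while the target moves along the sequence. The depth `m`, two levels
  -- per step, depends on the sequence alone, so it is available before `s` is chosen.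
  Std-β* : ∀ n {t t′ : Λ∞ V} → t →β* t′ → ∃[ m ] (∀ {s} → Std m s t → Std n s t′)
  Std-β* n (ε e) = n , λ d → Std-respʳ n d e
  Std-β* n (x ◅ xs) with m , h ← Std-β* n xs = suc (suc m) , λ d → h (Std-β m x d)

  -- Head reduction cut at the binders: weak head steps until an abstraction appears, then the same
  -- in its body. Each stage is thus stable under substitution and under application to an argument.
  data HN {V : Set} (s : Λ∞ V) : Set where
    neutral : ∀ {t} → s →w* t → Neutral t → HN s
    abs     : ∀ {u} → s →w* ƛ u → HN u → HN s

  HN-expand : {s t : Λ∞ V} → s →w* t → HN t → HN s
  HN-expand xs (neutral ys n) = neutral (Star-trans →w-respˡ xs ys) n
  HN-expand xs (abs ys h) = abs (Star-trans →w-respˡ xs ys) h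

  Neutral-resp : {s t : Λ∞ V} → s ≈ t → Neutral t → Neutral s
  Neutral-resp e (head f b) = head (≈-trans e f) b
  Neutral-resp e (app f n) = app (≈-trans e f) n

  -- The levels of `Std` needed to recover the head: one for each node on the spine, the head atom
  -- included, and none for the arguments.
  Neutral-depth : {t : Λ∞ V} → Neutral t → ℕ
  Neutral-depth (head _ _) = 1
  Neutral-depth (app _ n) = suc (Neutral-depth n)

  HNF-depth : {t : Λ∞ V} → HNF t → ℕ
  HNF-depth (neutral n) = Neutral-depth n
  HNF-depth (abs _ h) = suc (HNF-depth h)

  Neutral-reflect : {s t : Λ∞ V} (n : Neutral t) → Std (Neutral-depth n) s t →
                    ∃[ s′ ] (s →w* s′) × Neutral s′
  Neutral-reflect (head e b) (atom f xs) = _ , xs , head (≈-trans (≈-sym f) e) b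
  Neutral-reflect (head e b) (app f _ _ _) with () ← ≈-root f e
  Neutral-reflect (head e b) (abs f _ _) with () ← ≈-root f e
  Neutral-reflect (app e n) (atom f _) with () ← ≈-root f e
  Neutral-reflect (app e n) (abs f _ _) with () ← ≈-root f e
  Neutral-reflect (app e n) (app f xs x y)
    with s′ , ys , n′ ← Neutral-reflect n (Std-respʳ _ x (proj₁ (·-injective (≈-trans (≈-sym f) e)))) =
    _ , Star-trans →w-respˡ xs (→w*-·ˡ ys) , app ≈-refl n′

  HNF-reflect : {s t : Λ∞ V} (h : HNF t) → Std (HNF-depth h) s t → HN s
  HNF-reflect (neutral n) d with _ , xs , n′ ← Neutral-reflect n d = neutral xs n′
  HNF-reflect (abs e h) (atom f _) with () ← ≈-root f e
  HNF-reflect (abs e h) (app f _ _ _) with () ← ≈-root f e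
  HNF-reflect (abs e h) (abs f xs x) =
    abs xs (HNF-reflect h (Std-respʳ _ x (ƛ-injective (≈-trans (≈-sym f) e))))

  HasHNF⇒HN : {s : Λ∞ V} → HasHNF s → HN s
  HasHNF⇒HN (t , xs , h) with m , d ← Std-β* (HNF-depth h) xs = HNF-reflect h (d (Std-refl m))

  HasHNF-respˡ : {s t : Λ∞ V} → s ≈ t → HasHNF t → HasHNF s
  HasHNF-respˡ e (_ , xs , h) = _ , Star-respˡ →β-respˡ e xs , h

  HN⇒HasHNF : {s : Λ∞ V} → HN s → HasHNF s
  HN⇒HasHNF (neutral xs n) = _ , Star-map (λ t → t) (λ e → e) →w⇒→β xs , neutral n
  HN⇒HasHNF (abs xs h) with _ , ys , h′ ← HN⇒HasHNF h =
    _ , Star-trans →β-respˡ (Star-map (λ t → t) (λ e → e) →w⇒→β xs) (→β*-ƛ ys) , abs ≈-refl h′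

  -- Head normal forms of substituted terms and of applications

  var-neutral : {t : Λ∞ V} {x : V} → t ≈ ⟨ var x ⟩ → Neutral t
  var-neutral e = head e (λ ())

  Neutral-sub⁻ : {σ : V → Λ∞ W} {u : Λ∞ V} {t : Λ∞ W} → t ≈ sub σ u → Neutral t → Neutral u
  Neutral-sub⁻ {σ = σ} {u} e n with view u
  ... | var x f = var-neutral f
  Neutral-sub⁻ {σ = σ} e (head g b) | con c f
    with refl ← ≈-root (≈-trans e (sub-con {σ = σ} f)) g = head f (λ { refl → b refl })
  Neutral-sub⁻ {σ = σ} e (head g b) | app _ _ f with () ← ≈-root (≈-trans e (sub-app {σ = σ} f)) g
  Neutral-sub⁻ {σ = σ} e (head g b) | lam _ f with () ← ≈-root (≈-trans e (sub-lam {σ = σ} f)) g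
  Neutral-sub⁻ {σ = σ} e (app g n) | con c f with () ← ≈-root (≈-trans e (sub-con {σ = σ} f)) g
  Neutral-sub⁻ {σ = σ} e (app g n) | lam _ f with () ← ≈-root (≈-trans e (sub-lam {σ = σ} f)) g
  Neutral-sub⁻ {σ = σ} e (app g n) | app _ _ f =
    app f (Neutral-sub⁻ (proj₁ (·-injective (≈-trans (≈-sym g) (≈-trans e (sub-app {σ = σ} f))))) n)

  -- The contracted redex either is an instance of one in `u` or was created by `σ`. In the second
  -- case a variable is applied at the head of `u`, so `u` is neutral.
  →w-sub⁻ : {σ : V → Λ∞ W} {u : Λ∞ V} {t t′ : Λ∞ W} → t ≈ sub σ u → t →w t′ →
            Neutral u ⊎ ∃[ u′ ] (u →w u′) × (t′ ≈ sub σ u′)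
  →w-sub⁻ {u = u} e x with view u
  ... | var _ f = inj₁ (var-neutral f)
  →w-sub⁻ {σ = σ} e (base g h) | con c f with () ← ≈-root (≈-trans e (sub-con {σ = σ} f)) g
  →w-sub⁻ {σ = σ} e (base g h) | lam _ f with () ← ≈-root (≈-trans e (sub-lam {σ = σ} f)) g
  →w-sub⁻ {σ = σ} e (base g h) | app u₁ u₂ f
    with k₁ , k₂ ← ·-injective (≈-trans (≈-sym g) (≈-trans e (sub-app {σ = σ} f))) with view u₁
  ... | con c f₁ with () ← ≈-root (≈-trans k₁ (sub-con {σ = σ} f₁)) ≈-refl
  ... | var x f₁ = inj₁ (app f (var-neutral f₁))
  ... | app _ _ f₁ with () ← ≈-root (≈-trans k₁ (sub-app {σ = σ} f₁)) ≈-refl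
  ... | lam u₃ f₁ = inj₂ (u₃ [ u₂ ] , base (≈-trans f (·-cong f₁ ≈-refl)) ≈-refl ,
          ≈-trans h (≈-trans (sub-cong (inst-cong k₂) (ƛ-injective (≈-trans k₁ (sub-lam {σ = σ} f₁))))
            (≈-sym (sub-[] σ u₃ u₂))))
  →w-sub⁻ {σ = σ} e (appˡ g x h) | con c f with () ← ≈-root (≈-trans e (sub-con {σ = σ} f)) g
  →w-sub⁻ {σ = σ} e (appˡ g x h) | lam _ f with () ← ≈-root (≈-trans e (sub-lam {σ = σ} f)) g
  →w-sub⁻ {σ = σ} e (appˡ g x h) | app u₁ u₂ f
    with k₁ , k₂ ← ·-injective (≈-trans (≈-sym g) (≈-trans e (sub-app {σ = σ} f)))
    with →w-sub⁻ {σ = σ} k₁ x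
  ... | inj₁ n = inj₁ (app f n)
  ... | inj₂ (u₁′ , y , k) =
    inj₂ (u₁′ · u₂ , appˡ f y ≈-refl , ≈-trans h (≈-trans (·-cong k k₂) (≈-sym (sub-app {σ = σ} ≈-refl))))

  →w*-sub⁻ : {σ : V → Λ∞ W} {u : Λ∞ V} {t t′ : Λ∞ W} → t ≈ sub σ u → t →w* t′ →
             ∃[ u′ ] (u →w* u′) × (Neutral u′ ⊎ t′ ≈ sub σ u′)
  →w*-sub⁻ e (ε f) = _ , ε ≈-refl , inj₂ (≈-trans (≈-sym f) e)
  →w*-sub⁻ {σ = σ} e (x ◅ xs) with →w-sub⁻ {σ = σ} e x
  ... | inj₁ n = _ , ε ≈-refl , inj₁ n
  ... | inj₂ (_ , y , f) with _ , ys , r ← →w*-sub⁻ {σ = σ} f xs = _ , y ◅ ys , r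

  HN-sub⁻ : {σ : V → Λ∞ W} {u : Λ∞ V} {t : Λ∞ W} → t ≈ sub σ u → HN t → HN u
  HN-sub⁻ {σ = σ} e (neutral xs n) with →w*-sub⁻ {σ = σ} e xs
  ... | _ , ys , inj₁ n′ = neutral ys n′
  ... | _ , ys , inj₂ f = neutral ys (Neutral-sub⁻ {σ = σ} f n)
  HN-sub⁻ {σ = σ} e (abs xs h) with →w*-sub⁻ {σ = σ} e xs
  ... | _ , ys , inj₁ n′ = neutral ys n′
  ... | u′ , ys , inj₂ f with view u′
  ...   | con c g with () ← ≈-root (≈-trans f (sub-con {σ = σ} g)) ≈-refl
  -- Here the abstraction came from `σ x`; the variable itself is already an hnf.
  ...   | var x g = neutral ys (var-neutral g)
  ...   | app _ _ g with () ← ≈-root (≈-trans f (sub-app {σ = σ} g)) ≈-refl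
  ...   | lam _ g = abs (Star-respʳ ys g) (HN-sub⁻ (ƛ-injective (≈-trans f (sub-lam {σ = σ} g))) h)

  →w*-·⁻ : {s s₁ s₂ t : Λ∞ V} → s ≈ s₁ · s₂ → s →w* t →
           (∃[ t₁ ] (s₁ →w* t₁) × t ≈ t₁ · s₂) ⊎ (∃[ u ] (s₁ →w* ƛ u) × (u [ s₂ ] →w* t))
  →w*-·⁻ e (ε f) = inj₁ (_ , ε ≈-refl , ≈-trans (≈-sym f) e)
  →w*-·⁻ e (base {u} f g ◅ xs) with h₁ , h₂ ← ·-injective (≈-trans (≈-sym e) f) =
    inj₂ (_ , ε h₁ , Star-respˡ →w-respˡ (≈-sym (≈-trans g (sub-cong (inst-cong (≈-sym h₂)) (≈-refl {s = u})))) xs)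
  →w*-·⁻ e (appˡ f x g ◅ xs) with h₁ , h₂ ← ·-injective (≈-trans (≈-sym e) f)
    with →w*-·⁻ (≈-trans g (·-cong ≈-refl (≈-sym h₂))) xs
  ... | inj₁ (_ , ys , k) = inj₁ (_ , →w-respˡ h₁ x ◅ ys , k)
  ... | inj₂ (_ , ys , zs) = inj₂ (_ , →w-respˡ h₁ x ◅ ys , zs)

  -- If the root is contracted on the way, `s₁` has become some `ƛ u` and `u [ s₂ ]` has an hnf;
  -- `HN-sub⁻` then removes the substitution. Otherwise the hnf is an application whose function
  -- part is a reduct of `s₁`.
  HN-·⁻ : {s s₁ s₂ : Λ∞ V} → s ≈ s₁ · s₂ → HN s → HN s₁
  HN-·⁻ {s₂ = s₂} e (neutral xs n) with →w*-·⁻ e xs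
  ... | inj₂ (_ , ys , zs) = abs ys (HN-sub⁻ {σ = inst s₂} ≈-refl (neutral zs n))
  HN-·⁻ e (neutral xs (head g b)) | inj₁ (_ , ys , f) with () ← ≈-root g f
  HN-·⁻ e (neutral xs (app g n)) | inj₁ (_ , ys , f) =
    neutral ys (Neutral-resp (proj₁ (·-injective (≈-trans (≈-sym f) g))) n)
  HN-·⁻ {s₂ = s₂} e (abs xs h) with →w*-·⁻ e xs
  ... | inj₁ (_ , _ , f) with () ← f [] tt
  ... | inj₂ (_ , ys , zs) = abs ys (HN-sub⁻ {σ = inst s₂} ≈-refl (abs zs h))

  -- Parallel ⊥-reduction

  -- The labels determine which children have to be related, so _⇒⊥_, which lives in
  -- Set₁, coincides with the intersection of its finite approximations; that
  -- intersection lies in Set and can occur in the witness relation of a Greatest.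
  Par : ℕ → Relation
  Par zero s t = ⊤
  Par (suc n) s t = ParallelStep (Par n) s t

  infix 4 _⇛_

  _⇛_ : Relation
  s ⇛ t = ∀ n → Par n s t

  R⊥-resp : {s s′ t t′ : Λ∞ V} → s ≈ s′ → t ≈ t′ → R⊥ s t → R⊥ s′ t′
  R⊥-resp e f (h , b , g) =
    (λ h′ → h (HasHNF-respˡ e h′)) , (λ e′ → b (≈-trans e e′)) , ≈-trans (≈-sym f) g

  Par-resp : ∀ n {s s′ t t′ : Λ∞ V} → s ≈ s′ → t ≈ t′ → Par n s t → Par n s′ t′
  Par-resp zero _ _ _ = tt
  Par-resp (suc n) e f (base r) = base (R⊥-resp e f r)
  Par-resp (suc n) e f (atom g h) = atom (≈-trans (≈-sym e) g) (≈-trans (≈-sym f) h)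
  Par-resp (suc n) e f (app g h x y) = app (≈-trans (≈-sym e) g) (≈-trans (≈-sym f) h) x y
  Par-resp (suc n) e f (abs g h x) = abs (≈-trans (≈-sym e) g) (≈-trans (≈-sym f) h) x

  -- The first approximation settles the case. For an application or an abstraction, root labels
  -- force all higher approximations into the same case, so the relations between the children can
  -- be collected over all depths.
  ⇛-step : {s t : Λ∞ V} → s ⇛ t → ParallelStep _⇛_ s t
  ⇛-step p with p 1
  ... | base r = base r
  ... | atom e f = atom e f
  ... | app {s₁} {s₂} {t₁} {t₂} e f _ _ =
    app e f (λ n → proj₁ (children n)) (λ n → proj₂ (children n))
    where
    children : ∀ n → Par n s₁ t₁ × Par n s₂ t₂
    children n with p (suc n)
    ... | base (_ , _ , g) with () ← ≈-root f g
    ... | atom g _ with () ← ≈-root e g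
    ... | abs g _ _ with () ← ≈-root e g
    ... | app g h x y
      with g₁ , g₂ ← ·-injective (≈-trans (≈-sym g) e) | h₁ , h₂ ← ·-injective (≈-trans (≈-sym h) f) =
      Par-resp n g₁ h₁ x , Par-resp n g₂ h₂ y
  ... | abs {s′} {t′} e f _ = abs e f child
    where
    child : ∀ n → Par n s′ t′
    child n with p (suc n)
    ... | base (_ , _ , g) with () ← ≈-root f g
    ... | atom g _ with () ← ≈-root e g
    ... | app g _ _ _ with () ← ≈-root e g
    ... | abs g h x = Par-resp n (ƛ-injective (≈-trans (≈-sym g) e)) (ƛ-injective (≈-trans (≈-sym h) f)) x

  ⇛-unstep : {s t : Λ∞ V} → ParallelStep _⇛_ s t → s ⇛ t
  ⇛-unstep _ zero = tt
  ⇛-unstep (base r) (suc n) = base r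
  ⇛-unstep (atom e f) (suc n) = atom e f
  ⇛-unstep (app e f x y) (suc n) = app e f (x n) (y n)
  ⇛-unstep (abs e f x) (suc n) = abs e f (x n)

  ⇛-resp : {s s′ t t′ : Λ∞ V} → s ≈ s′ → t ≈ t′ → s ⇛ t → s′ ⇛ t′
  ⇛-resp e f p n = Par-resp n e f (p n)

  Par-refl : ∀ n {s : Λ∞ V} → Par n s s
  Par-refl zero = tt
  Par-refl (suc n) {s} with view s
  ... | con c e = atom e e
  ... | var x e = atom e e
  ... | app a b e = app e e (Par-refl n) (Par-refl n)
  ... | lam a e = abs e e (Par-refl n)

  ⇛-refl : {s : Λ∞ V} → s ⇛ s
  ⇛-refl n = Par-refl n

  -- `σ` and `τ` may be unrelated because the target is a constant, fixed by every substitution.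
  R⊥-sub : {σ τ : V → Λ∞ W} {s t : Λ∞ V} → R⊥ s t → R⊥ (sub σ s) (sub τ t)
  R⊥-sub {σ = σ} {τ} {s} (h , b , e) =
    (λ h′ → h (HN⇒HasHNF (HN-sub⁻ {σ = σ} ≈-refl (HasHNF⇒HN h′)))) , not-bot , sub-con {σ = τ} e
    where
    not-bot : ¬ (sub σ s ≈ ⟨ con bot ⟩)
    not-bot f with view s
    ... | con c g with refl ← ≈-root (sub-con {σ = σ} g) f = b g
    -- `σ` may send this variable to `bot`, but a variable is an hnf, contradicting `h`.
    ... | var x g = h (_ , ε ≈-refl , neutral (var-neutral g))
    ... | app _ _ g with () ← ≈-root (sub-app {σ = σ} g) f
    ... | lam _ g with () ← ≈-root (sub-lam {σ = σ} g) f

  R⊥-ren : {ρ : V → W} {s t : Λ∞ V} → R⊥ s t → R⊥ (ren ρ s) (ren ρ t)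
  R⊥-ren {ρ = ρ} {s} {t} r =
    R⊥-resp (sub≈ren (λ _ → ≈-refl) s) (sub≈ren (λ _ → ≈-refl) t)
      (R⊥-sub {σ = λ x → ⟨ var (ρ x) ⟩} {λ x → ⟨ var (ρ x) ⟩} r)

  Par-ren : ∀ n {ρ : V → W} {s t : Λ∞ V} → Par n s t → Par n (ren ρ s) (ren ρ t)
  Par-ren zero _ = tt
  Par-ren (suc n) (base r) = base (R⊥-ren r)
  Par-ren (suc n) (atom e f) = atom (ren-atom e) (ren-atom f)
  Par-ren (suc n) (app e f x y) = app (ren-app e) (ren-app f) (Par-ren n x) (Par-ren n y)
  Par-ren (suc n) (abs e f x) = abs (ren-lam e) (ren-lam f) (Par-ren n x)

  ⇛-lift : {σ τ : V → Λ∞ W} → (∀ x → σ x ⇛ τ x) → ∀ x → lift σ x ⇛ lift τ x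
  ⇛-lift h nothing = ⇛-refl
  ⇛-lift h (just x) n = Par-ren n (h x n)

  Par-sub : ∀ n {σ τ : V → Λ∞ W} {s t : Λ∞ V} → (∀ x → σ x ⇛ τ x) → Par n s t → Par n (sub σ s) (sub τ t)
  Par-sub zero h _ = tt
  Par-sub (suc n) {σ} {τ} h (base r) = base (R⊥-sub {σ = σ} {τ} r)
  Par-sub (suc n) {σ} {τ} h (atom {con c} e f) = atom (sub-con {σ = σ} e) (sub-con {σ = τ} f)
  Par-sub (suc n) {σ} {τ} h (atom {var x} e f) =
    Par-resp (suc n) (≈-sym (sub-var {σ = σ} e)) (≈-sym (sub-var {σ = τ} f)) (h x (suc n))
  Par-sub (suc n) h (app e f x y) = app (sub-app e) (sub-app f) (Par-sub n h x) (Par-sub n h y)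
  Par-sub (suc n) h (abs e f x) = abs (sub-lam e) (sub-lam f) (Par-sub n (⇛-lift h) x)

  ⇛-[] : {u u′ : Λ∞ (Maybe V)} {v v′ : Λ∞ V} → u ⇛ u′ → v ⇛ v′ → u [ v ] ⇛ u′ [ v′ ]
  ⇛-[] {v = v} {v′} p q n = Par-sub n h (p n)
    where
    h : ∀ x → inst v x ⇛ inst v′ x
    h nothing = q
    h (just x) = ⇛-refl

  -- Simulation of reductions along ⇛

  ⇛-·⁻ : {s t s₁ s₂ : Λ∞ V} → s ≈ s₁ · s₂ → HN s → s ⇛ t →
         ∃[ t₁ ] ∃[ t₂ ] t ≈ t₁ · t₂ × s₁ ⇛ t₁ × s₂ ⇛ t₂
  ⇛-·⁻ e h p with ⇛-step p
  ... | base (b , _) = ⊥-elim (b (HN⇒HasHNF h))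
  ... | atom f _ with () ← ≈-root e f
  ... | abs f _ _ with () ← ≈-root e f
  ... | app f g x y with k₁ , k₂ ← ·-injective (≈-trans (≈-sym f) e) =
    _ , _ , g , ⇛-resp k₁ ≈-refl x , ⇛-resp k₂ ≈-refl y

  ⇛-ƛ⁻ : {s t : Λ∞ V} {u : Λ∞ (Maybe V)} → s ≈ ƛ u → HN s → s ⇛ t → ∃[ v ] t ≈ ƛ v × u ⇛ v
  ⇛-ƛ⁻ e h p with ⇛-step p
  ... | base (b , _) = ⊥-elim (b (HN⇒HasHNF h))
  ... | atom f _ with () ← ≈-root e f
  ... | app f _ _ _ with () ← ≈-root e f
  ... | abs f g x = _ , g , ⇛-resp (ƛ-injective (≈-trans (≈-sym f) e)) ≈-refl x

  -- A ⊥-step could erase the redex only at a node on the path from the root to its abstraction. By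
  -- `HN-·⁻` all these nodes have an hnf, so the redex survives in `t`.
  ⇛-→w : {s s′ t : Λ∞ V} → s →w s′ → HN s → s ⇛ t → ∃[ t′ ] (t →w t′) × s′ ⇛ t′
  ⇛-→w (base e f) h p with t₁ , t₂ , g , p₁ , p₂ ← ⇛-·⁻ e h p
    with u′ , k , q ← ⇛-ƛ⁻ ≈-refl (HN-·⁻ e h) p₁ =
    u′ [ t₂ ] , base (≈-trans g (·-cong k ≈-refl)) ≈-refl , ⇛-resp (≈-sym f) ≈-refl (⇛-[] q p₂)
  ⇛-→w (appˡ e x f) h p with t₁ , t₂ , g , p₁ , p₂ ← ⇛-·⁻ e h p
    with t₁′ , y , q ← ⇛-→w x (HN-·⁻ e h) p₁ =
    t₁′ · t₂ , appˡ g y ≈-refl , ⇛-unstep (app f ≈-refl q p₂)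

  ⇛-→w* : {s s′ t : Λ∞ V} → s →w* s′ → HN s′ → s ⇛ t → ∃[ t′ ] (t →w* t′) × s′ ⇛ t′
  ⇛-→w* (ε e) h p = _ , ε ≈-refl , ⇛-resp e ≈-refl p
  ⇛-→w* (x ◅ xs) h p with _ , y , q ← ⇛-→w x (HN-expand (x ◅ xs) h) p
    with _ , ys , r ← ⇛-→w* xs h q = _ , y ◅ ys , r

  ⇛-Neutral : {s t : Λ∞ V} → Neutral s → s ⇛ t → Neutral t
  ⇛-Neutral (head e b) p with ⇛-step p
  ... | base (h , _) = ⊥-elim (h (_ , ε ≈-refl , neutral (head e b)))
  ... | app f _ _ _ with () ← ≈-root e f
  ... | abs f _ _ with () ← ≈-root e f
  ... | atom f g with refl ← ≈-root e f = head g b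
  ⇛-Neutral (app e n) p
    with _ , _ , g , p₁ , _ ← ⇛-·⁻ e (neutral (ε ≈-refl) (app e n)) p = app g (⇛-Neutral n p₁)

  ⇛-HN : {s t : Λ∞ V} → HN s → s ⇛ t → HN t
  ⇛-HN (neutral xs n) p with _ , ys , q ← ⇛-→w* xs (neutral (ε ≈-refl) n) p =
    neutral ys (⇛-Neutral n q)
  ⇛-HN (abs xs h) p with _ , ys , q ← ⇛-→w* xs (abs (ε ≈-refl) h) p
    with _ , f , r ← ⇛-ƛ⁻ ≈-refl (abs (ε ≈-refl) h) q = abs (Star-respʳ ys f) (⇛-HN h r)

  ⇛-R⊥ : {s t u : Λ∞ V} → s ⇛ t → R⊥ t u → R⊥ s u
  ⇛-R⊥ {s = s} p (h , b , e) = (λ h′ → h (HN⇒HasHNF (⇛-HN (HasHNF⇒HN h′) p))) , not-bot , e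
    where
    not-bot : ¬ (s ≈ ⟨ con bot ⟩)
    not-bot f with p 1
    ... | base (_ , b′ , _) = b′ f
    ... | atom g k with refl ← ≈-root g f = b k
    ... | app g _ _ _ with () ← ≈-root g f
    ... | abs g _ _ with () ← ≈-root g f

  -- Postponement for finite reductions

  ⇛-app⁻ : {s t t₁ t₂ : Λ∞ V} → t ≈ t₁ · t₂ → s ⇛ t →
           ∃[ s₁ ] ∃[ s₂ ] s ≈ s₁ · s₂ × s₁ ⇛ t₁ × s₂ ⇛ t₂
  ⇛-app⁻ e p with ⇛-step p
  ... | base (_ , _ , f) with () ← ≈-root e f
  ... | atom _ f with () ← ≈-root e f
  ... | abs _ f _ with () ← ≈-root e f
  ... | app f g x y with k₁ , k₂ ← ·-injective (≈-trans (≈-sym g) e) =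
    _ , _ , f , ⇛-resp ≈-refl k₁ x , ⇛-resp ≈-refl k₂ y

  ⇛-lam⁻ : {s t : Λ∞ V} {u : Λ∞ (Maybe V)} → t ≈ ƛ u → s ⇛ t → ∃[ v ] s ≈ ƛ v × v ⇛ u
  ⇛-lam⁻ e p with ⇛-step p
  ... | base (_ , _ , f) with () ← ≈-root e f
  ... | atom _ f with () ← ≈-root e f
  ... | app _ f _ _ with () ← ≈-root e f
  ... | abs f g x = _ , f , ⇛-resp ≈-refl (ƛ-injective (≈-trans (≈-sym g) e)) x

  -- The application and the abstraction of a β-redex in `t` must come from the same nodes in `s`,
  -- since a ⊥-step yields only an atom. So `s` has the redex as well.
  postpone : {s t u : Λ∞ V} → s ⇛ t → t →β⊥ u → ∃[ r ] (s →β* r) × r ⇛ u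
  -- No β-step is made: one root ⊥-step replaces the whole pending parallel step.
  postpone p (base (inj₂ r)) = _ , ε ≈-refl , ⇛-unstep (base (⇛-R⊥ p r))
  postpone p (base (inj₁ (_ , _ , e , f))) with _ , _ , g , p₁ , p₂ ← ⇛-app⁻ e p
    with _ , k , q ← ⇛-lam⁻ ≈-refl p₁ =
    _ , base (_ , _ , ≈-trans g (·-cong k ≈-refl) , ≈-refl) ◅ ε ≈-refl ,
    ⇛-resp ≈-refl (≈-sym f) (⇛-[] q p₂)
  postpone p (appˡ e x f) with _ , _ , g , p₁ , p₂ ← ⇛-app⁻ e p
    with _ , ys , q ← postpone p₁ x =
    _ , Star-respˡ →β-respˡ g (→β*-· ys (ε ≈-refl)) , ⇛-unstep (app ≈-refl f q p₂)
  postpone p (appʳ e x f) with _ , _ , g , p₁ , p₂ ← ⇛-app⁻ e p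
    with _ , ys , q ← postpone p₂ x =
    _ , Star-respˡ →β-respˡ g (→β*-· (ε ≈-refl) ys) , ⇛-unstep (app ≈-refl f p₁ q)
  postpone p (abs e x f) with _ , g , p₁ ← ⇛-lam⁻ e p with _ , ys , q ← postpone p₁ x =
    _ , Star-respˡ →β-respˡ g (→β*-ƛ ys) , ⇛-unstep (abs ≈-refl f q)

  postpone* : {s t u : Λ∞ V} → s ⇛ t → Star _→β⊥_ t u → ∃[ r ] (s →β* r) × r ⇛ u
  postpone* p (ε e) = _ , ε ≈-refl , ⇛-resp ≈-refl e p
  postpone* p (x ◅ xs) with _ , ys , q ← postpone p x with _ , zs , r ← postpone* q xs =
    _ , Star-trans →β-respˡ ys zs , r

  ⇛⇒⇒⊥ : {s t : Λ∞ V} → s ⇛ t → s ⇒⊥ t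
  ⇛⇒⇒⊥ p = _⇛_ , ⇛-step , p

  -- Layerwise construction of the infinite β-reduct

  module Construction (X : Relation)
    (unfold : ∀ {V} {s t : Λ∞ V} → X s t → InfinitaryStep _→β⊥_ X s t) where

    infix 4 _⇛X_

    -- The state of the corecursion: a pending parallel ⊥-step, then the rest of the given
    -- infinitary reduction.
    _⇛X_ : Relation
    s ⇛X t = ∃[ u ] s ⇛ u × X u t

    data Step {V : Set} (s t : Λ∞ V) : Set where
      atom : ∀ {r} → s →β* r → r ⇛ t → Step s t
      app  : ∀ {s₁ s₂ t₁ t₂} → t ≈ t₁ · t₂ → s →β* (s₁ · s₂) → s₁ ⇛X t₁ → s₂ ⇛X t₂ → Step s t
      abs  : ∀ {s′ t′} → t ≈ ƛ t′ → s →β* (ƛ s′) → s′ ⇛X t′ → Step s t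

    step : {s t : Λ∞ V} → s ⇛X t → Step s t
    step (_ , p , x) with unfold x
    ... | atom e xs with _ , ys , q ← postpone* p xs = atom ys (⇛-resp ≈-refl (≈-sym e) q)
    ... | app e xs x₁ x₂ with _ , ys , q ← postpone* p xs
      with _ , _ , f , q₁ , q₂ ← ⇛-app⁻ ≈-refl q =
      app e (Star-respʳ ys f) (_ , q₁ , x₁) (_ , q₂ , x₂)
    ... | abs e xs x′ with _ , ys , q ← postpone* p xs with _ , f , q′ ← ⇛-lam⁻ ≈-refl q =
      abs e (Star-respʳ ys f) (_ , q′ , x′)

    mutual
      -- Since terms are functions on paths, corecursion becomes structural recursion on the path,
      -- with one unfolding of `X` per direction.
      reduct : {s t : Λ∞ V} → s ⇛X t → Λ∞ V
      reduct x p = stepReduct (step x) p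

      stepReduct : {s t : Λ∞ V} → Step s t → Λ∞ V
      stepReduct (atom {r} _ _) p = r p
      stepReduct (app _ _ x y) [] = app
      stepReduct (app _ _ x y) (fun ∷ p) = reduct x p
      stepReduct (app _ _ x y) (arg ∷ p) = reduct y p
      stepReduct (app _ _ x y) (body ∷ p) = app
      stepReduct (abs _ _ x) [] = lam
      stepReduct (abs _ _ x) (fun ∷ p) = app
      stepReduct (abs _ _ x) (arg ∷ p) = app
      stepReduct (abs _ _ x) (body ∷ p) = reduct x p

    -- The first summand is needed because the reduct may be infinite where t is ⊥.
    Xβ : Relation
    Xβ {V} s r = (s →β* r) ⊎ (Σ[ t ∈ Λ∞ V ] Σ[ x ∈ s ⇛X t ] r ≈ reduct x)

    Xβ-star : {s r : Λ∞ V} → s →β* r → InfinitaryStep _→β_ Xβ s r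
    Xβ-star {r = r} xs with view r
    ... | con c e = atom e (Star-respʳ xs e)
    ... | var x e = atom e (Star-respʳ xs e)
    ... | app _ _ e = app e (Star-respʳ xs e) (inj₁ (ε ≈-refl)) (inj₁ (ε ≈-refl))
    ... | lam _ e = abs e (Star-respʳ xs e) (inj₁ (ε ≈-refl))

    Xβ-step : {s r t : Λ∞ V} (y : Step s t) → r ≈ stepReduct y → InfinitaryStep _→β_ Xβ s r
    Xβ-step (atom xs _) e = Xβ-star (Star-respʳ xs (≈-sym e))
    Xβ-step (app _ xs x y) e =
      app (≈-trans e (≈-app refl ≈-refl ≈-refl)) xs (inj₂ (_ , x , ≈-refl)) (inj₂ (_ , y , ≈-refl))
    Xβ-step (abs _ xs x) e = abs (≈-trans e (≈-lam refl ≈-refl)) xs (inj₂ (_ , x , ≈-refl))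

    Xβ-unfold : {s r : Λ∞ V} → Xβ s r → InfinitaryStep _→β_ Xβ s r
    Xβ-unfold (inj₁ xs) = Xβ-star xs
    Xβ-unfold (inj₂ (_ , x , e)) = Xβ-step (step x) e

    -- Induction on the depth follows the construction level by level; where it stopped at an atom
    -- of the target, the pending ⊥-step stored there finishes the argument.
    reduct-⇛ : ∀ n {s t : Λ∞ V} (x : s ⇛X t) → Par n (reduct x) t
    stepReduct-⇛ : ∀ n {s t : Λ∞ V} (y : Step s t) → Par n (stepReduct y) t
    reduct-⇛ n x = stepReduct-⇛ n (step x)
    stepReduct-⇛ zero _ = tt
    stepReduct-⇛ (suc n) (atom _ p) = p (suc n)
    stepReduct-⇛ (suc n) (app e _ x y) =
      app (≈-app refl ≈-refl ≈-refl) e (reduct-⇛ n x) (reduct-⇛ n y)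
    stepReduct-⇛ (suc n) (abs e _ x) = abs (≈-lam refl ≈-refl) e (reduct-⇛ n x)

  postponement : {s t : Λ∞ V} → s →β⊥∞ t → ∃[ r ] (s →β∞ r) × (r ⇒⊥ t)
  postponement {s = s} (X , unfold , x) =
    reduct x′ , (Xβ , Xβ-unfold , inj₂ (_ , x′ , ≈-refl)) , ⇛⇒⇒⊥ (λ n → reduct-⇛ n x′)
    where
    open Construction X unfold
    x′ : s ⇛X _
    -- Nothing has been postponed yet, so the pending ⊥-step starts as the identity.
    x′ = s , ⇛-refl , x

theorem5p30 : (V C : Set) (bot : C) →
    let open InfinitaryLambda C bot in
    (s t : Λ∞ V) → s →β⊥∞ t → ∃[ r ] (s →β∞ r) × (r ⇒⊥ t)
theorem5p30 V C bot s t = Postponement.postponement C bot
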